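{- $\diamondsuit_{2^{<\omega_1}}$ holds in $\mathsf{ZFC}$.
   Context: $2^{<\omega_1}$ is the tree of all functions $s:\alpha\to 2$ with $\alpha<\omega_1$, ordered by inclusion (end-extension). For a tree $T$ with root $\emptyset$ and $t\in T$, $t{\downarrow}=\{s\in T\mid s<_T t\}$. An antichain is a set of pairwise incomparable nodes. A set $U\subseteq T$ is special if it is a union of at most countably many antichains; otherwise it is nonspecial. For $X\subseteq T$, a map $f:X\to T$ is regressive if $f(t)<_T t$ for all $t\in X\setminus\{\emptyset\}$. For $T$ of height $\omega_1$, $NS^T$ is the ideal of all $B\subseteq T$ for which there is a regressive $f:B\to T$ such that $f^{ -1}(\{t\})$ is special for every $t\in T$. For a nonspecial tree $T$ of height $\omega_1$, $\diamondsuit_T$ asserts that there is a sequence $(D_t\mid t\in T)$ with $D_t\subseteq t{\downarrow}$ for all $t\in T$ such that for every $X\subseteq T$, $\{t\in T\mid X\cap t{\downarrow}=D_t\}\notin NS^T$. -}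

module Defs where

open import Level using (0ℓ; suc)
open import Data.Bool.Base using (Bool)
open import Data.Empty using (⊥-elim-irr)
open import Data.Irrelevant using ([_])
open import Data.Nat.Base using (ℕ)
open import Data.Product.Base using (Σ-syntax; ∃-syntax; _×_; _,_)
open import Data.Refinement using (Refinement-syntax; _,_; value)
open import Data.Sum.Base using (_⊎_)
open import Function.Bundles using (_↣_)
open import Induction.WellFounded using (WellFounded)
open import Relation.Binary.Core using (Rel)
open import Relation.Binary.PropositionalEquality.Core using (_≡_; _≢_)
open import Relation.Binary.Structures using (IsStrictTotalOrder)
import Relation.Binary.Construct.NonStrictToStrict as ToStrict
open import Relation.Nullary.Negation.Core using (¬_)
open import Relation.Unary using (Pred; _∈_; _∉_; _⊆_; _≐_; _∩_; ⋃)

-- ZFC is rendered as type theory with ExcludedMiddle 0ℓ and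
-- Extensionality 0ℓ 0ℓ.  ExcludedMiddle decides arbitrary types, hence
-- selects an element of every nonempty type, which gives the axiom of
-- choice.  Extensionality makes nodes of 2^<ω₁ equal when they are equal
-- as set-theoretic functions, so maps and predicates on nodes are
-- automatically well defined.

-- A set is countable when it injects into ℕ; finite sets are included.

Countable : Set → Set
Countable A = A ↣ ℕ

-- ω₁ up to isomorphism: an uncountable well-ordered set all of whose
-- proper initial segments are countable.  The ordinal α corresponds to
-- the set [ β ∈ Carrier ∣ β < α ] of smaller elements.
-- Under the two axioms above such a structure exists: take Brouwer trees
-- data B = zero | sup (ℕ → B), with sup f the least ordinal above all
-- f n, and select one representative of each order-equivalence class.

record ω₁ : Set₁ where
  infix 4 _<_
  field
    Carrier            : Set
    _<_                : Rel Carrier 0ℓ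
    isStrictTotalOrder : IsStrictTotalOrder _≡_ _<_
    wellFounded        : WellFounded _<_
    segmentsCountable  : ∀ α → Countable [ β ∈ Carrier ∣ β < α ]
    uncountable        : ¬ Countable Carrier
    0#                 : Carrier
    0#-minimum         : ∀ {α} → ¬ (α < 0#)

-- Specialness, NS^T and ♢_T depend on T only through its strict order
-- and its root.  Subsets of T are predicates.  No assumption that T is
-- nonspecial is needed: if T is special, constant maps to the root
-- show that NS contains every subset, so that ♢ fails.

module TreeNotions {T : Set} (_<_ : Rel T 0ℓ) (∅ : T) where

  _↓ : T → Pred T 0ℓ
  (t ↓) s = s < t

  Antichain : Pred T 0ℓ → Set
  Antichain A = ∀ {s t} → s ∈ A → t ∈ A → s ≢ t → ¬ (s < t ⊎ t < s)

  -- The empty set is an antichain, so ℕ-indexed unions cover finite ones too.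

  Special : Pred T 0ℓ → Set₁
  Special U = Σ[ A ∈ (ℕ → Pred T 0ℓ) ]
    (∀ n → Antichain (A n)) × (U ≐ ⋃ ℕ A)

  -- Membership proofs in [ t ∈ T ∣ t ∈ X ] are irrelevant, so f depends
  -- only on the node.

  Regressive : (X : Pred T 0ℓ) → ([ t ∈ T ∣ t ∈ X ] → T) → Set
  Regressive X f = ∀ x → value x ≢ ∅ → f x < value x

  Fibre : (X : Pred T 0ℓ) → ([ t ∈ T ∣ t ∈ X ] → T) → T → Pred T 0ℓ
  Fibre X f t s = ∃[ x ] value x ≡ s × f x ≡ t

  NS : Pred (Pred T 0ℓ) (suc 0ℓ)
  NS B = Σ[ f ∈ ([ t ∈ T ∣ t ∈ B ] → T) ]
    Regressive B f × (∀ t → Special (Fibre B f t))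

  ♢ : Set₁
  ♢ = Σ[ D ∈ (T → Pred T 0ℓ) ]
    (∀ t → D t ⊆ t ↓) ×
    ((X : Pred T 0ℓ) → (λ t → X ∩ t ↓ ≐ D t) ∉ NS)

module BinaryTree (Ω : ω₁) where

  open ω₁ Ω

  2^<ω₁ : Set
  2^<ω₁ = Σ[ α ∈ Carrier ] ([ β ∈ Carrier ∣ β < α ] → Bool)

  -- Inclusion of functions as sets of ordered pairs.

  _⊑_ : Rel 2^<ω₁ 0ℓ
  (_ , s) ⊑ (_ , t) = ∀ x → ∃[ y ] value x ≡ value y × s x ≡ t y

  open ToStrict _≡_ _⊑_ public using () renaming (_<_ to _⊏_)

  ∅ : 2^<ω₁
  ∅ = 0# , λ { (_ , [ β<0 ]) → ⊥-elim-irr (0#-minimum β<0) }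

  open TreeNotions _⊏_ ∅ public using () renaming (♢ to ♢-2^<ω₁)

{-# OPTIONS --safe #-}

-- Put t ↾ β into D t exactly when t(β) = 1.  Given X, let b : ω₁ → 2 satisfy
-- b(β) = 1 iff b ↾ β ∈ X; then D guesses X at every node of the branch b.
-- Suppose f is regressive on these nodes and has special fibres.  A chain
-- meets an antichain at most once, so b ↾ β is determined by f(b ↾ β) and the
-- index n(β) of an antichain of its fibre.  Iterating f reaches the root after
-- finitely many steps, so the list of indices met on the way determines β, and
-- ω₁ would be countable.

module Submission where

open import Defs
open import Level using (0ℓ)
open import Axiom.ExcludedMiddle using (ExcludedMiddle)
open import Axiom.Extensionality.Propositional using (Extensionality)

open import Data.Bool.Base using (Bool; true)
open import Data.Empty using (⊥-elim-irr)
open import Data.Irrelevant using ([_])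
open import Data.Nat.Base as ℕ using (ℕ; zero; suc)
open import Data.Nat.Properties using (*-cancelˡ-≡; even≢odd; suc-injective)
open import Data.Product.Base using (∃-syntax; _×_; _,_; proj₁; proj₂)
open import Data.Refinement using (_,_; value)
open import Data.Sum.Base using (inj₁; inj₂)
open import Function.Base using (_∘_)
open import Function.Bundles using (mk↣)
open import Induction.WellFounded using (Acc; acc; WellFounded; module All; module FixPoint)
open import Relation.Binary.Core using (Rel)
open import Relation.Binary.Definitions using (DecidableEquality; tri<; tri≈; tri>)
open import Relation.Binary.PropositionalEquality
  using (_≡_; _≢_; refl; sym; trans; cong; subst; subst₂)
open import Relation.Binary.Structures using (IsStrictTotalOrder)
open import Relation.Nullary.Decidable using (does; proof; yes; no; dec-true; recompute)
open import Relation.Nullary.Negation.Core using (contradiction)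
open import Relation.Nullary.Reflects using (Reflects; invert)
open import Relation.Unary using (Pred; _∈_; _∉_; _≐_; _∩_)

-- This is 2^m (2n + 1), so parity separates the two clauses.
pair : ℕ → ℕ → ℕ
pair zero    n = suc (2 ℕ.* n)
pair (suc m) n = 2 ℕ.* pair m n

pair-injective : ∀ m n m′ n′ → pair m n ≡ pair m′ n′ → m ≡ m′ × n ≡ n′
pair-injective zero    n zero     n′ eq = refl , *-cancelˡ-≡ n n′ 2 (suc-injective eq)
pair-injective zero    n (suc m′) n′ eq = contradiction (sym eq) (even≢odd (pair m′ n′) n)
pair-injective (suc m) n zero     n′ eq = contradiction eq (even≢odd (pair m n) n′)
pair-injective (suc m) n (suc m′) n′ eq
  with refl , n≡n′ ← pair-injective m n m′ n′ (*-cancelˡ-≡ (pair m n) (pair m′ n′) 2 eq) =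
  refl , n≡n′

module _ {A : Set} {_<_ : Rel A 0ℓ} (wf : WellFounded _<_) (_≟_ : DecidableEquality A)
         (0# : A) (g : A → A) (g-regressive : ∀ {x} → x ≢ 0# → g x < x)
         (n : A → ℕ)
         (g,n-injective : ∀ {x y} → x ≢ 0# → y ≢ 0# → g x ≡ g y → n x ≡ n y → x ≡ y)
         where

  private
    -- The list of indices met on the descent to `0#`, folded into one number: 0 is the empty list,
    -- and `suc` keeps the others apart from it.
    code : ∀ x → Acc _<_ x → ℕ
    code x (acc rec) with x ≟ 0#
    ... | yes _   = 0
    ... | no x≢0# = suc (pair (n x) (code (g x) (rec (g-regressive x≢0#))))

    -- Equal codes record descents of equal length, so both reach `0#` together and `g,n-injective`
    -- carries equality back up. The accessibility proofs are independent, since `g x` and `g y` are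
    -- compared before they are known to be equal.
    code-injective : ∀ {x y} (p : Acc _<_ x) (q : Acc _<_ y) → code x p ≡ code y q → x ≡ y
    code-injective {x} {y} (acc p) (acc q) eq with x ≟ 0# | y ≟ 0#
    ... | yes x≡0# | yes y≡0# = trans x≡0# (sym y≡0#)
    ... | no x≢0#  | no y≢0#
      with nx≡ny , eq′ ← pair-injective (n x) _ (n y) _ (suc-injective eq) =
      g,n-injective x≢0# y≢0# (code-injective (p _) (q _) eq′) nx≡ny

  regressive⇒countable : Countable A
  regressive⇒countable = mk↣ {to = λ x → code x (wf x)} (code-injective (wf _) (wf _))

module _ (em : ExcludedMiddle 0ℓ) (ext : Extensionality 0ℓ 0ℓ) (Ω : ω₁) where

  open ω₁ Ω
  open IsStrictTotalOrder isStrictTotalOrder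
    using (compare; _≟_; _<?_; irrefl) renaming (trans to <-trans)
  open BinaryTree Ω
  open TreeNotions _⊏_ ∅

  ⊏⇒< : ∀ {s t} → s ⊏ t → proj₁ s < proj₁ t
  ⊏⇒< {β , s} {α , t} (s⊑t , s≢t) with compare β α
  ... | tri< β<α _ _ = β<α
  ... | tri≈ _ refl _ = contradiction (cong (β ,_) (ext s≗t)) s≢t
    where
    s≗t : ∀ x → s x ≡ t x
    s≗t x with s⊑t x
    ... | (_ , [ _ ]) , refl , sx≡tx = sx≡tx
  -- Now α is in the domain of `s`, so inclusion would put it in the domain of `t`, the set of
  -- elements below α.
  ... | tri> _ _ α<β with s⊑t (α , [ α<β ])
  ...   | (_ , [ α<α ]) , refl , _ = ⊥-elim-irr (irrefl refl α<α)

  _↾_ : (Carrier → Bool) → Carrier → 2^<ω₁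
  b ↾ α = α , λ x → b (value x)

  ↾-mono : ∀ b {β α} → β < α → (b ↾ β) ⊏ (b ↾ α)
  ↾-mono b {β} {α} β<α =
    (λ { (γ , [ γ<β ]) → (γ , [ <-trans γ<β β<α ]) , refl , refl }) ,
    λ eq → irrefl (cong proj₁ eq) β<α

  ⊏↾⇒≡↾ : ∀ b {α s} → s ⊏ (b ↾ α) → s ≡ b ↾ proj₁ s
  ⊏↾⇒≡↾ b {s = β , s} (s⊑b , _) = cong (β ,_) (ext λ x → s≗b x (s⊑b x))
    where
    s≗b : ∀ x → ∃[ y ] value x ≡ value y × s x ≡ b (value y) → s x ≡ b (value x)
    s≗b x (_ , x≡y , sx≡by) = trans sx≡by (cong b (sym x≡y))

  antichain-↾ : ∀ b {A β γ} → Antichain A → b ↾ β ∈ A → b ↾ γ ∈ A → β ≡ γ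
  antichain-↾ b {β = β} {γ} anti β∈A γ∈A with compare β γ
  ... | tri< β<γ β≢γ _ = contradiction (inj₁ (↾-mono b β<γ)) (anti β∈A γ∈A (β≢γ ∘ cong proj₁))
  ... | tri≈ _ β≡γ _   = β≡γ
  ... | tri> _ β≢γ γ<β = contradiction (inj₂ (↾-mono b γ<β)) (anti β∈A γ∈A (β≢γ ∘ cong proj₁))

  -- Away from the root, `fb α` lies on the branch and is recovered from its height. So `f` induces
  -- a regressive map on ω₁ itself, and `regressive⇒countable` applies to it.
  branch∉NS : ∀ b {B} → (∀ α → b ↾ α ∈ B) → B ∉ NS
  branch∉NS b {B} b∈B (f , f-regressive , special) =
    uncountable (regressive⇒countable wellFounded _≟_ 0# (proj₁ ∘ fb) (⊏⇒< ∘ fb⊏) n fb,n-injective)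
    where
    fb : Carrier → 2^<ω₁
    fb α = f (b ↾ α , [ b∈B α ])

    fb⊏ : ∀ {α} → α ≢ 0# → fb α ⊏ (b ↾ α)
    fb⊏ α≢0# = f-regressive _ (α≢0# ∘ cong proj₁)

    layer : 2^<ω₁ → ℕ → Pred 2^<ω₁ 0ℓ
    layer t = proj₁ (special t)

    ∈layer : ∀ α → ∃[ n ] b ↾ α ∈ layer (fb α) n
    ∈layer α = proj₁ (proj₂ (proj₂ (special (fb α)))) ((b ↾ α , [ b∈B α ]) , refl , refl)

    n : Carrier → ℕ
    n = proj₁ ∘ ∈layer

    fb,n-injective : ∀ {β γ} → β ≢ 0# → γ ≢ 0# →
                     proj₁ (fb β) ≡ proj₁ (fb γ) → n β ≡ n γ → β ≡ γ
    fb,n-injective {β} {γ} β≢0# γ≢0# ht≡ n≡ =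
      -- Both nodes lie in the same antichain of the same fibre once `fb β` is rewritten to `fb γ`.
      antichain-↾ b (proj₁ (proj₂ (special (fb γ))) (n γ))
        (subst₂ (λ t k → b ↾ β ∈ layer t k) fb≡ n≡ (proj₂ (∈layer β)))
        (proj₂ (∈layer γ))
      where
      fb≡ : fb β ≡ fb γ
      fb≡ = trans (⊏↾⇒≡↾ b (fb⊏ β≢0#)) (trans (cong (b ↾_) ht≡) (sym (⊏↾⇒≡↾ b (fb⊏ γ≢0#))))

  D : 2^<ω₁ → Pred 2^<ω₁ 0ℓ
  D (α , t) s = s ⊏ (α , t) × ∃[ x ] value x ≡ proj₁ s × t x ≡ true

  module _ (X : Pred 2^<ω₁ 0ℓ) where

    private
      -- The value at α depends only on the node formed by the earlier values. Nodes carry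
      -- irrelevant bounds while the recursion asks for relevant ones, hence `recompute`.
      step : ∀ α → (∀ {β} → β < α → Bool) → Bool
      step α b = does (em {X (α , λ { (β , [ β<α ]) → b (recompute (β <? α) β<α) })})

      -- The unfolding equation of well-founded recursion requires that `step` respect pointwise
      -- equality.
      step-ext : ∀ α {b b′ : ∀ {β} → β < α → Bool} →
                 (∀ {β} (β<α : β < α) → b β<α ≡ b′ β<α) → step α b ≡ step α b′
      step-ext α b≗b′ =
        cong (λ t → does (em {X (α , t)})) (ext λ { (β , [ β<α ]) → b≗b′ (recompute (β <? α) β<α) })

    X-branch : Carrier → Bool
    X-branch = All.wfRec wellFounded 0ℓ (λ _ → Bool) step

    X-branch-unfold : ∀ α → X-branch α ≡ does (em {X (X-branch ↾ α)})
    X-branch-unfold α = FixPoint.unfold-wfRec wellFounded (λ _ → Bool) step step-ext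

    X-branch-guessed : ∀ α → X ∩ ((X-branch ↾ α) ↓) ≐ D (X-branch ↾ α)
    X-branch-guessed α = to , from
      where
      to : ∀ {s} → s ∈ X ∩ ((X-branch ↾ α) ↓) → s ∈ D (X-branch ↾ α)
      to {s} (s∈X , s⊏b) = s⊏b , (proj₁ s , [ ⊏⇒< s⊏b ]) , refl ,
        trans (X-branch-unfold (proj₁ s)) (dec-true em (subst X (⊏↾⇒≡↾ X-branch s⊏b) s∈X))

      from : ∀ {s} → s ∈ D (X-branch ↾ α) → s ∈ X ∩ ((X-branch ↾ α) ↓)
      -- The bit at the height of `s` is the outcome of `em`; being `true`, it yields a proof that
      -- the restriction of the branch to that height is in `X`.
      from {s} (s⊏b , (_ , _) , refl , bs≡true) = subst X (sym (⊏↾⇒≡↾ X-branch s⊏b))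
        (invert (subst (Reflects _) (trans (sym (X-branch-unfold (proj₁ s))) bs≡true) (proof em))) , s⊏b

theorem3p28 : ExcludedMiddle 0ℓ → Extensionality 0ℓ 0ℓ → (Ω : ω₁) → BinaryTree.♢-2^<ω₁ Ω
theorem3p28 em ext Ω =
  D em ext Ω , (λ _ → proj₁) ,
  λ X → branch∉NS em ext Ω (X-branch em ext Ω X) (X-branch-guessed em ext Ω X)
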